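{- Let $m,n\geq 1$, let $[w_1,w_1']$ be an interval in $\mathscr{D}_m$ and $[w_2,w_2']$ an interval in $\mathscr{D}_n$. Then the interval $[w_1,w_1']\,\sharp\,[w_2,w_2']=[w_1\,\sharp\,w_2,\;w_1'\,\sharp\,w_2']$ of $\mathscr{D}_{m+n-1}$ is isomorphic as a poset to the cartesian product of the intervals $[w_1,w_1']$ and $[w_2,w_2']$.
   Context: A Dyck path of size $n\geq 0$ is a word of length $2n$ in the letters $0,1$ with $n$ letters $1$ and $n$ letters $0$ such that every prefix contains at least as many $1$'s as $0$'s (the height after a prefix is its number of $1$'s minus its number of $0$'s). Let $\mathscr{D}_n$ be the set of Dyck paths of size $n$. A subpath of a Dyck path $w$ is a non-empty sequence $x$ of consecutive letters of $w$ that starts and ends at the same height and stays strictly above that height in between. A subpath $x$ is movable in $w$ if it is immediately preceded in $w$ by the letter $0$ and either $x$ ends at the last letter of $w$ or $x$ is immediately followed in $w$ by the letter $1$. For a movable subpath $x$, let $N=N(w,x)\geq 1$ be the number of consecutive letters $0$ just before $x$, so $w=a\,0^{N}\,x\,b$ where $a$ does not end with $0$; for $1\leq i\leq N$ let $M(w,x,i)=a\,0^{N-i}\,x\,0^{i}\,b\in\mathscr{D}_n$. Let $\Gamma_n$ be the directed graph on $\mathscr{D}_n$ with edges $w\to M(w,x,i)$ for all movable $x$ in $w$ and all $1\leq i\leq N(w,x)$. The dexter order is: $u\leq v$ if and only if there is a directed path (possibly of length $0$) from $u$ to $v$ in $\Gamma_n$. This is a partial order whose cover relations are exactly the edges of $\Gamma_n$.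 Product $\sharp$ on non-empty Dyck paths: for a non-empty Dyck path $w$, let $\overline{w}$ be the word obtained by removing its first and last letters (a pseudo-Dyck path; its height, starting at $0$, may reach $-1$). For pseudo-Dyck paths $p,q$, write $p=(p',0^k)$ where $p'$ is empty (if $p$ is empty) or ends with $1$, and $q=q'q''$ where $q'$ is the largest prefix of $q$ in which the height stays $\geq 0$; set $p\ast q=(p',q',0^k,q'')$. Then $u\,\sharp\,v=(1,\overline{u}\ast\overline{v},0)$. This is associative with unit $(1,0)$; if $u\in\mathscr{D}_m$ and $v\in\mathscr{D}_n$ then $u\,\sharp\,v\in\mathscr{D}_{m+n-1}$. Moreover $w_1\leq w_1'$ and $w_2\leq w_2'$ imply $w_1\,\sharp\,w_2\leq w_1'\,\sharp\,w_2'$, so the product of intervals in the claim is well defined. -}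

module Defs where

open import Data.Bool using (Bool; true; false; _≟_; _<_; f<t)
import Data.Bool.Properties as Bool
open import Data.Empty using (⊥-elim)
import Data.Integer as ℤ
import Data.Integer.Properties as ℤ
open import Data.List using (List; []; _∷_; [_]; _++_; _∷ʳ_; length; filter; inits; take; drop; replicate; initLast; _∷ʳ′_)
open import Data.List.Properties using (filter-++; length-++)
open import Data.List.Relation.Unary.All using (All; []; _∷_)
import Data.List.Relation.Unary.All as All
import Data.List.Relation.Unary.All.Properties as All
open import Data.List.Relation.Binary.Lex.Strict using (Lex-<; halt; this; next; <-transitive; <-irreflexive)
import Data.List.Relation.Binary.Pointwise as Pointwise
open import Data.Nat using (ℕ; zero; suc; _+_; _∸_; _≤_; z≤n; s≤s; NonZero)
import Data.Nat.Properties as ℕ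
open import Data.Product using (_×_; _,_; ∃-syntax; proj₁; proj₂)
open import Data.Sum using (_⊎_; inj₁; inj₂)
open import Level using (0ℓ; _⊔_)
open import Relation.Binary using (Poset; Rel)
open import Relation.Binary.Construct.Closure.ReflexiveTransitive using (Star; ε; _◅_; _◅◅_)
import Relation.Binary.Construct.On as On
open import Relation.Binary.Morphism.Structures using (IsOrderIsomorphism)
open import Relation.Binary.PropositionalEquality hiding ([_])
open import Relation.Nullary using (¬_)

Word : Set
Word = List Bool

pattern 𝟘 = false
pattern 𝟙 = true

# : Bool → Word → ℕ
# c w = length (filter (c ≟_) w)

height : Word → ℤ.ℤ
height w = # 𝟙 w ℤ.⊖ # 𝟘 w

-- Length 2n follows from the two letter counts.  The proof fields have at
-- most one inhabitant each, so equality of Dyck paths is equality of words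
-- (`Dyck-≡`).
record Dyck (n : ℕ) : Set where
  field
    word   : Word
    ones   : # 𝟙 word ≡ n
    zeros  : # 𝟘 word ≡ n
    prefix : All (λ p → # 𝟘 p ≤ # 𝟙 p) (inits word)

open Dyck public

Dyck-≡ : ∀ {n} {u v : Dyck n} → word u ≡ word v → u ≡ v
Dyck-≡ {u = u} {v} refl
  rewrite ℕ.≡-irrelevant (ones u) (ones v)
        | ℕ.≡-irrelevant (zeros u) (zeros v)
        | All.irrelevant ℕ.≤-irrelevant (prefix u) (prefix v)
  = refl

-- `IsSubpath a x`: in any word of the form a x b, the occurrence of x
-- after a is a subpath.
record IsSubpath (a x : Word) : Set where
  field
    nonEmpty : x ≢ []
    returns  : height (a ++ x) ≡ height a
    above    : ∀ y z → x ≡ y ++ z → y ≢ [] → z ≢ [] →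
               height a ℤ.< height (a ++ y)

-- A movable subpath x of w, as the occurrence w = a 0ᴺ x b.
record Movable (w : Word) : Set where
  field
    a x b         : Word
    N             : ℕ
    decomposition : w ≡ a ++ replicate N 𝟘 ++ x ++ b
    subpath       : IsSubpath (a ++ replicate N 𝟘) x
    preceded      : 1 ≤ N
    followed      : b ≡ [] ⊎ ∃[ b′ ] b ≡ 𝟙 ∷ b′
    maximal       : ¬ (∃[ a′ ] a ≡ a′ ∷ʳ 𝟘)

open Movable using (N)

M : (w : Word) → Movable w → ℕ → Word
M w s i = a ++ replicate (N s ∸ i) 𝟘 ++ x ++ replicate i 𝟘 ++ b
  where open Movable s hiding (N)

infix 4 _⟶_ _⊑_

_⟶_ : ∀ {n} → Rel (Dyck n) 0ℓ
u ⟶ v = ∃[ s ] ∃[ i ] 1 ≤ i × i ≤ N s × word v ≡ M (word u) s i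

_⊑_ : ∀ {n} → Rel (Dyck n) 0ℓ
_⊑_ = Star _⟶_

-- Antisymmetry: every edge increases the word lexicographically.
_≺_ : Rel Word 0ℓ
_≺_ = Lex-< _≡_ _<_

≺-trans : ∀ {u v w} → u ≺ v → v ≺ w → u ≺ w
≺-trans = <-transitive isEquivalence (resp₂ _<_) Bool.<-trans

≺-irrefl : ∀ {u} → ¬ u ≺ u
≺-irrefl = <-irreflexive Bool.<-irrefl (Pointwise.refl refl)

#-++ : ∀ c u v → # c (u ++ v) ≡ # c u + # c v
#-++ c u v = trans (cong length (filter-++ (c ≟_) u v))
                   (length-++ (filter (c ≟_) u))

height-𝟘 : ∀ a → height (a ++ [ 𝟘 ]) ℤ.< height a
height-𝟘 a
  rewrite #-++ 𝟙 a [ 𝟘 ] | #-++ 𝟘 a [ 𝟘 ] | ℕ.+-identityʳ (# 𝟙 a) | ℕ.+-comm (# 𝟘 a) 1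
  = ℤ.⊖-monoʳ->-< (# 𝟙 a) (ℕ.n<1+n (# 𝟘 a))

subpath-𝟙 : ∀ {a x} → IsSubpath a x → ∃[ y ] x ≡ 𝟙 ∷ y
subpath-𝟙 {a} {[]}         s = ⊥-elim (IsSubpath.nonEmpty s refl)
subpath-𝟙 {a} {𝟙 ∷ x}      s = x , refl
subpath-𝟙 {a} {𝟘 ∷ []}     s = ⊥-elim (ℤ.<-irrefl (IsSubpath.returns s) (height-𝟘 a))
subpath-𝟙 {a} {𝟘 ∷ c ∷ x}  s = ⊥-elim
  (ℤ.<-asym (height-𝟘 a) (IsSubpath.above s [ 𝟘 ] (c ∷ x) refl (λ ()) (λ ())))

≺-++ : ∀ a {u v} → u ≺ v → (a ++ u) ≺ (a ++ v)
≺-++ []      p = p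
≺-++ (c ∷ a) p = next refl (≺-++ a p)

≺-zeros : ∀ N i {u v} → 1 ≤ i → i ≤ N →
          (replicate N 𝟘 ++ u) ≺ (replicate (N ∸ i) 𝟘 ++ 𝟙 ∷ v)
≺-zeros (suc N) (suc zero)    {u} {v} _ _ = ≺-one N
  where
  ≺-one : ∀ N → (replicate (suc N) 𝟘 ++ u) ≺ (replicate N 𝟘 ++ 𝟙 ∷ v)
  ≺-one zero    = this f<t
  ≺-one (suc N) = next refl (≺-one N)
≺-zeros (suc N) (suc (suc i)) {u} {v} _ (s≤s i≤N) =
  weaken (N ∸ suc i) (≺-zeros N (suc i) (s≤s z≤n) i≤N)
  where
  weaken : ∀ k {t} → t ≺ (replicate k 𝟘 ++ 𝟙 ∷ v) → (𝟘 ∷ t) ≺ (replicate k 𝟘 ++ 𝟙 ∷ v)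
  weaken zero          _          = this f<t
  weaken (suc k) {[]}    p          = next refl (nonempty k)
    where
    nonempty : ∀ k → [] ≺ (replicate k 𝟘 ++ 𝟙 ∷ v)
    nonempty zero    = halt
    nonempty (suc k) = halt
  weaken (suc k) {𝟘 ∷ t} (next _ p) = next refl (weaken k p)

⟶⇒≺ : ∀ {n} {u v : Dyck n} → u ⟶ v → word u ≺ word v
⟶⇒≺ (s , i , 1≤i , i≤N , eq) with subpath-𝟙 (Movable.subpath s)
... | y , refl = subst₂ _≺_ (sym (Movable.decomposition s)) (sym eq)
                   (≺-++ (Movable.a s) (≺-zeros (N s) i 1≤i i≤N))

⊑⇒ : ∀ {n} {u v : Dyck n} → u ⊑ v → u ≡ v ⊎ word u ≺ word v
⊑⇒ ε = inj₁ refl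
⊑⇒ (_◅_ {u} {w} e p) with ⊑⇒ p | ⟶⇒≺ {u = u} {v = w} e
... | inj₁ refl | q = inj₂ q
... | inj₂ r    | q = inj₂ (≺-trans q r)

⊑-antisym : ∀ {n} {u v : Dyck n} → u ⊑ v → v ⊑ u → u ≡ v
⊑-antisym p q with ⊑⇒ p | ⊑⇒ q
... | inj₁ u≡v | _        = u≡v
... | inj₂ _   | inj₁ v≡u = sym v≡u
... | inj₂ r   | inj₂ s   = ⊥-elim (≺-irrefl (≺-trans r s))

𝒟 : ℕ → Poset 0ℓ 0ℓ 0ℓ
𝒟 n = record
  { Carrier        = Dyck n
  ; _≈_            = _≡_
  ; _≤_            = _⊑_
  ; isPartialOrder = record
    { isPreorder = record
      { isEquivalence = isEquivalence
      ; reflexive     = λ { refl → ε }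
      ; trans         = _◅◅_
      }
    ; antisym = ⊑-antisym
    }
  }

module _ {c ℓ₁ ℓ₂} (P : Poset c ℓ₁ ℓ₂) where
  open Poset P renaming (_≤_ to _≤ₚ_)

  -- Elements are triples (w , u ≤ w , w ≤ v), compared on w alone.
  Interval : Carrier → Carrier → Poset (c ⊔ ℓ₂) ℓ₁ ℓ₂
  Interval u v = On.poset P (proj₁ {B = λ w → u ≤ₚ w × w ≤ₚ v})

infix 4 _≅_

_≅_ : ∀ {a ℓ₁ ℓ₂ b ℓ₃ ℓ₄} → Poset a ℓ₁ ℓ₂ → Poset b ℓ₃ ℓ₄ → Set (a ⊔ ℓ₁ ⊔ ℓ₂ ⊔ b ⊔ ℓ₃ ⊔ ℓ₄)
P ≅ Q = ∃[ f ] IsOrderIsomorphism P._≈_ Q._≈_ P._≤_ Q._≤_ f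
  where
  module P = Poset P
  module Q = Poset Q

bar : Word → Word
bar w = take (length w ∸ 2) (drop 1 w)

-- p ↦ (p′ , k), where p = p′ 0ᵏ and p′ is empty or ends with 1.
stripZeros : Word → Word × ℕ
stripZeros []      = [] , 0
stripZeros (𝟙 ∷ p) = 𝟙 ∷ proj₁ (stripZeros p) , proj₂ (stripZeros p)
stripZeros (𝟘 ∷ p) with stripZeros p
... | []     , k = [] , suc k
... | c ∷ p′ , k = 𝟘 ∷ c ∷ p′ , k

-- `cut h q` = (q′ , q″), where q = q′ q″ and q′ is the largest prefix of q
-- along which the height, starting from h, stays ≥ 0.
cut : ℕ → Word → Word × Word
cut h       []      = [] , []
cut h       (𝟙 ∷ q) = 𝟙 ∷ proj₁ (cut (suc h) q) , proj₂ (cut (suc h) q)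
cut zero    (𝟘 ∷ q) = [] , 𝟘 ∷ q
cut (suc h) (𝟘 ∷ q) = 𝟘 ∷ proj₁ (cut h q) , proj₂ (cut h q)

infixl 7 _∗_ _♯ʷ_ _♯_

_∗_ : Word → Word → Word
p ∗ q with stripZeros p | cut 0 q
... | p′ , k | q′ , q″ = p′ ++ q′ ++ replicate k 𝟘 ++ q″

_♯ʷ_ : Word → Word → Word
u ♯ʷ v = 𝟙 ∷ (bar u ∗ bar v) ++ [ 𝟘 ]

-- `Path h w l`: starting from height h, the word w stays at height ≥ 0
-- and ends at height l.
data Path : ℕ → Word → ℕ → Set where
  nil  : ∀ {h} → Path h [] h
  up   : ∀ {h l w} → Path (suc h) w l → Path h (𝟙 ∷ w) l
  down : ∀ {h l w} → Path h w l → Path (suc h) (𝟘 ∷ w) l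

infixr 5 _⋆_
_⋆_ : ∀ {h j l u v} → Path h u j → Path j v l → Path h (u ++ v) l
nil    ⋆ q = q
up p   ⋆ q = up (p ⋆ q)
down p ⋆ q = down (p ⋆ q)

split : ∀ {h l} u {v} → Path h (u ++ v) l → ∃[ j ] Path h u j × Path j v l
split []      p = _ , nil , p
split (𝟙 ∷ u) (up p) with split u p
... | j , q , r = j , up q , r
split (𝟘 ∷ u) (down p) with split u p
... | j , q , r = j , down q , r

shift : ∀ {h l w} k → Path h w l → Path (h + k) w (l + k)
shift k nil      = nil
shift k (up p)   = up (shift k p)
shift k (down p) = down (shift k p)

Path-# : ∀ {h l w} → Path h w l → h + # 𝟙 w ≡ # 𝟘 w + l
Path-# {h} nil            = ℕ.+-identityʳ h
Path-# {h} (up {w = w} p) = trans (ℕ.+-suc h (# 𝟙 w)) (Path-# p)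
Path-# (down p)           = cong suc (Path-# p)

Path-prefix : ∀ {h l w} → Path h w l → All (λ p → # 𝟘 p ≤ h + # 𝟙 p) (inits w)
Path-prefix nil      = z≤n ∷ []
Path-prefix {h} (up p) = z≤n ∷ All.map⁺
  (All.map (λ {x} le → ℕ.≤-trans le (ℕ.≤-reflexive (sym (ℕ.+-suc h (# 𝟙 x))))) (Path-prefix p))
Path-prefix (down p) = z≤n ∷ All.map⁺ (All.map s≤s (Path-prefix p))

toPath : ∀ {h l} w → h + # 𝟙 w ≡ # 𝟘 w + l →
         All (λ p → # 𝟘 p ≤ h + # 𝟙 p) (inits w) → Path h w l
toPath {h} [] eq _ = subst (Path h []) (trans (sym (ℕ.+-identityʳ h)) eq) nil
toPath {h} (𝟙 ∷ w) eq (_ ∷ ps) = up (toPath w (trans (sym (ℕ.+-suc h (# 𝟙 w))) eq)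
  (All.map (λ {x} le → ℕ.≤-trans le (ℕ.≤-reflexive (ℕ.+-suc h (# 𝟙 x)))) (All.map⁻ ps)))
toPath {zero}  (𝟘 ∷ w) eq (_ ∷ () ∷ _)
toPath {suc h} (𝟘 ∷ w) eq (_ ∷ ps) =
  down (toPath w (ℕ.suc-injective eq) (All.map (λ { (s≤s le) → le }) (All.map⁻ ps)))

Dyck⇒Path : ∀ {n} (u : Dyck n) → Path 0 (word u) 0
Dyck⇒Path u = toPath (word u)
  (trans (ones u) (trans (sym (zeros u)) (sym (ℕ.+-identityʳ _)))) (prefix u)

take-length : ∀ (u v : Word) → take (length u) (u ++ v) ≡ u
take-length []      v = refl
take-length (c ∷ u) v = cong (c ∷_) (take-length u v)

bar-∷ʳ : ∀ p → bar (𝟙 ∷ p ∷ʳ 𝟘) ≡ p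
bar-∷ʳ p = trans
  (cong (λ k → take (k ∸ 1) (p ∷ʳ 𝟘)) (trans (length-++ p) (ℕ.+-comm (length p) 1)))
  (take-length p [ 𝟘 ])

bar-Path : ∀ {w} → w ≢ [] → Path 0 w 0 → w ≡ 𝟙 ∷ bar w ++ [ 𝟘 ] × Path 1 (bar w) 1
bar-Path ne nil = ⊥-elim (ne refl)
bar-Path ne (up {w = w} p) with initLast w
bar-Path ne (up ())            | []
bar-Path ne (up p)             | r ∷ʳ′ c with split r p
bar-Path ne (up p)             | r ∷ʳ′ 𝟙 | j , q , up ()
bar-Path ne (up p)             | r ∷ʳ′ 𝟘 | j , q , down nil
  rewrite bar-∷ʳ r = refl , q

stripZeros-++ : ∀ p → p ≡ proj₁ (stripZeros p) ++ replicate (proj₂ (stripZeros p)) 𝟘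
stripZeros-++ []      = refl
stripZeros-++ (𝟙 ∷ p) = cong (𝟙 ∷_) (stripZeros-++ p)
stripZeros-++ (𝟘 ∷ p) with stripZeros p | stripZeros-++ p
... | []     , k | eq = cong (𝟘 ∷_) eq
... | c ∷ p′ , k | eq = cong (𝟘 ∷_) eq

stripZeros-last : ∀ p → proj₁ (stripZeros p) ≡ [] ⊎ ∃[ r ] proj₁ (stripZeros p) ≡ r ∷ʳ 𝟙
stripZeros-last []      = inj₁ refl
stripZeros-last (𝟙 ∷ p) with stripZeros p | stripZeros-last p
... | p′ , k | inj₁ refl       = inj₂ ([] , refl)
... | p′ , k | inj₂ (r , refl) = inj₂ (𝟙 ∷ r , refl)
stripZeros-last (𝟘 ∷ p) with stripZeros p | stripZeros-last p
... | []     , k | _             = inj₁ refl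
... | c ∷ p′ , k | inj₂ (r , eq) = inj₂ (𝟘 ∷ r , cong (𝟘 ∷_) eq)

cut-++ : ∀ h q → q ≡ proj₁ (cut h q) ++ proj₂ (cut h q)
cut-++ h       []      = refl
cut-++ h       (𝟙 ∷ q) = cong (𝟙 ∷_) (cut-++ (suc h) q)
cut-++ zero    (𝟘 ∷ q) = refl
cut-++ (suc h) (𝟘 ∷ q) = cong (𝟘 ∷_) (cut-++ h q)

cut-Path : ∀ h q → Path (suc h) q 1 → Path h (proj₁ (cut h q)) 0 × Path 1 (proj₂ (cut h q)) 1
cut-Path zero    []      nil      = nil , nil
cut-Path h       (𝟙 ∷ q) (up p)   with cut-Path (suc h) q p
... | r , s = up r , s
cut-Path zero    (𝟘 ∷ q) p        = nil , p
cut-Path (suc h) (𝟘 ∷ q) (down p) with cut-Path h q p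
... | r , s = down r , s

zeros-Path : ∀ k {j l} → Path j (replicate k 𝟘) l → j ≡ k + l
zeros-Path zero    nil      = refl
zeros-Path (suc k) (down p) = cong suc (zeros-Path k p)

∗-Path : ∀ p q → Path 1 p 1 → Path 1 q 1 → Path 1 (p ∗ q) 1
∗-Path p q P Q with stripZeros p | stripZeros-++ p | cut 0 q | cut-Path 0 q Q
... | p′ , k | refl | q′ , q″ | Q′ , Q″ with split p′ P
...   | j , P′ , Z = P′ ⋆ shift j Q′ ⋆ Z ⋆ Q″

#-∗ : ∀ c p q → # c (p ∗ q) ≡ # c p + # c q
#-∗ c p q with stripZeros p | stripZeros-++ p | cut 0 q | cut-++ 0 q
... | p′ , k | refl | q′ , q″ | refl
  rewrite #-++ c p′ (q′ ++ replicate k 𝟘 ++ q″) | #-++ c q′ (replicate k 𝟘 ++ q″)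
        | #-++ c (replicate k 𝟘) q″ | #-++ c p′ (replicate k 𝟘) | #-++ c q′ q″
  = lemma (# c p′) (# c q′) (# c (replicate k 𝟘)) (# c q″)
  where
  lemma : ∀ a b d e → a + (b + (d + e)) ≡ a + d + (b + e)
  lemma a b d e = begin
    a + (b + (d + e)) ≡⟨ cong (a +_) (sym (ℕ.+-assoc b d e)) ⟩
    a + (b + d + e)   ≡⟨ cong (λ t → a + (t + e)) (ℕ.+-comm b d) ⟩
    a + (d + b + e)   ≡⟨ cong (a +_) (ℕ.+-assoc d b e) ⟩
    a + (d + (b + e)) ≡⟨ sym (ℕ.+-assoc a d (b + e)) ⟩
    a + d + (b + e)   ∎
    where open ≡-Reasoning

nonEmpty : ∀ {n} .{{_ : NonZero n}} (u : Dyck n) → word u ≢ []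
nonEmpty {suc n} u eq with trans (sym (ones u)) (cong (# 𝟙) eq)
... | ()

ones-bar : ∀ {n} .{{_ : NonZero n}} (u : Dyck n) → suc (# 𝟙 (bar (word u))) ≡ n
ones-bar u = begin
  suc (# 𝟙 (bar (word u)))             ≡⟨ cong suc (sym (ℕ.+-identityʳ _)) ⟩
  suc (# 𝟙 (bar (word u)) + 0)         ≡⟨ cong suc (sym (#-++ 𝟙 (bar (word u)) [ 𝟘 ])) ⟩
  # 𝟙 (𝟙 ∷ bar (word u) ++ [ 𝟘 ])      ≡⟨ cong (# 𝟙) (sym (proj₁ (bar-Path (nonEmpty u) (Dyck⇒Path u)))) ⟩
  # 𝟙 (word u)                         ≡⟨ ones u ⟩
  _                                    ∎
  where open ≡-Reasoning

module _ {m n} .{{_ : NonZero m}} .{{_ : NonZero n}} (u : Dyck m) (v : Dyck n) where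

  ♯-Path : Path 0 (word u ♯ʷ word v) 0
  ♯-Path = up (∗-Path (bar (word u)) (bar (word v))
                 (proj₂ (bar-Path (nonEmpty u) (Dyck⇒Path u)))
                 (proj₂ (bar-Path (nonEmpty v) (Dyck⇒Path v)))
               ⋆ down nil)

  ♯-ones : # 𝟙 (word u ♯ʷ word v) ≡ m + n ∸ 1
  ♯-ones = begin
    suc (# 𝟙 (bar (word u) ∗ bar (word v) ++ [ 𝟘 ])) ≡⟨ cong suc (#-++ 𝟙 (bar (word u) ∗ bar (word v)) [ 𝟘 ]) ⟩
    suc (# 𝟙 (bar (word u) ∗ bar (word v)) + 0)      ≡⟨ cong suc (ℕ.+-identityʳ _) ⟩
    suc (# 𝟙 (bar (word u) ∗ bar (word v)))          ≡⟨ cong suc (#-∗ 𝟙 (bar (word u)) (bar (word v))) ⟩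
    suc (x + y)                                      ≡⟨ sym (ℕ.+-suc x y) ⟩
    suc x + suc y ∸ 1                                ≡⟨ cong₂ (λ s t → s + t ∸ 1) (ones-bar u) (ones-bar v) ⟩
    m + n ∸ 1                                        ∎
    where
    open ≡-Reasoning
    x = # 𝟙 (bar (word u))
    y = # 𝟙 (bar (word v))

_♯_ : ∀ {m n} .{{_ : NonZero m}} .{{_ : NonZero n}} → Dyck m → Dyck n → Dyck (m + n ∸ 1)
u ♯ v = record
  { word   = word u ♯ʷ word v
  ; ones   = ♯-ones u v
  ; zeros  = trans (sym (trans (Path-# (♯-Path u v)) (ℕ.+-identityʳ _))) (♯-ones u v)
  ; prefix = Path-prefix (♯-Path u v)
  }

{-# OPTIONS --safe #-}
module Submission where

-- Write u = a 1 0ᵏ⁺¹ (cutting u after its last 1) and v = 1 q 0 r (cutting v at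
-- its first return to 0).  Then u ♯ v = a 1 q 0ᵏ⁺¹ r.  The number of 1's in a 1
-- is the size of u, so ♯ is injective on 𝒟 m × 𝒟 n, and every edge leaving u or
-- v induces an edge leaving u ♯ v.  Conversely, an edge that ends in the image of
-- ♯ starts in the image and comes from an edge in exactly one factor: a word
-- outside the image falls from a 1 q by a run of zeros that stops above height
-- 0, and no move repairs that.  So the image is a down-set on which the order is
-- the product order.

open import Defs
open import Data.Bool using (Bool)
open import Data.Empty using (⊥-elim)
import Data.Integer as ℤ
import Data.Integer.Properties as ℤ
open import Data.List using ([]; _∷_; [_]; _++_; replicate; take; inits; initLast; _∷ʳ_; _∷ʳ′_)
open import Data.List.Properties using (++-assoc; ++-cancelˡ; ++-conicalʳ; ++-identityʳ; ∷ʳ-injective; ∷ʳ-injectiveʳ; ∷-injectiveʳ)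
open import Data.List.Relation.Unary.All using (All; []; _∷_)
import Data.List.Relation.Unary.All.Properties as All
open import Data.Nat using (ℕ; zero; suc; NonZero; _+_; _∸_; _<_; _≤_; z≤n; s≤s)
import Data.Nat.Properties as ℕ
open import Data.Product using (_×_; _,_; ∃-syntax; proj₁; proj₂)
open import Data.Product.Relation.Binary.Pointwise.NonDependent using (×-poset)
open import Data.Sum using (_⊎_; inj₁; inj₂)
open import Function using (case_of_)
open import Relation.Binary using (Poset)
open import Relation.Binary.Construct.Closure.ReflexiveTransitive using (ε; _◅_; _◅◅_)
open import Relation.Binary.Definitions using (tri<; tri≈; tri>)
open import Relation.Binary.PropositionalEquality hiding ([_])
open import Relation.Nullary using (¬_)

-- Runs of zeros and positions of letters in words.

0^ : ℕ → Word
0^ k = replicate k 𝟘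

0^-∷ : ∀ k {s} → 0^ k ++ 𝟘 ∷ s ≡ 𝟘 ∷ 0^ k ++ s
0^-∷ zero    = refl
0^-∷ (suc k) = cong (𝟘 ∷_) (0^-∷ k)

0^-+ : ∀ j k {s} → 0^ (j + k) ++ s ≡ 0^ j ++ 0^ k ++ s
0^-+ zero    k = refl
0^-+ (suc j) k = cong (𝟘 ∷_) (0^-+ j k)

0^-+-suc : ∀ j k {s} → 0^ (suc (j + k)) ++ s ≡ 0^ j ++ 0^ (suc k) ++ s
0^-+-suc j k {s} = trans (cong (λ t → 0^ t ++ s) (sym (ℕ.+-suc j k))) (0^-+ j (suc k))

0^-no-𝟙 : ∀ k a {s} → 0^ k ≢ a ++ 𝟙 ∷ s
0^-no-𝟙 zero    []      ()
0^-no-𝟙 zero    (_ ∷ _) ()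
0^-no-𝟙 (suc k) []      ()
0^-no-𝟙 (suc k) (c ∷ a) eq = 0^-no-𝟙 k a (∷-injectiveʳ eq)

0^-injective : ∀ j k → 0^ j ≡ 0^ k → j ≡ k
0^-injective zero    zero    _  = refl
0^-injective (suc j) (suc k) eq = cong suc (0^-injective j k (∷-injectiveʳ eq))

reassoc : ∀ c {s t u : Word} → s ++ t ≡ u → (c ++ s) ++ t ≡ c ++ u
reassoc c eq = trans (++-assoc c _ _) (cong (c ++_) eq)

locate : ∀ (c : Word) {s} a {e t} → c ++ s ≡ a ++ e ∷ t →
         (∃[ d ] a ≡ c ++ d × s ≡ d ++ e ∷ t) ⊎ (∃[ d ] c ≡ a ++ e ∷ d × t ≡ d ++ s)
locate []      a       eq   = inj₁ (a , refl , eq)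
locate (x ∷ c) []      refl = inj₂ (c , refl , refl)
locate (x ∷ c) (y ∷ a) eq with refl ← cong (take 1) eq | locate c a (∷-injectiveʳ eq)
... | inj₁ (d , refl , eq′) = inj₁ (d , refl , eq′)
... | inj₂ (d , refl , eq′) = inj₂ (d , refl , eq′)

lastOne : ∀ s → ∃[ b ] ∃[ j ] 𝟙 ∷ s ≡ b ++ 𝟙 ∷ 0^ j
lastOne []      = [] , 0 , refl
lastOne (𝟙 ∷ s) with b , j , eq ← lastOne s = 𝟙 ∷ b , j , cong (𝟙 ∷_) eq
lastOne (𝟘 ∷ s) with lastOne s
... | []    , j , refl = [] , suc j , refl
... | 𝟙 ∷ b , j , refl = 𝟙 ∷ 𝟘 ∷ b , j , refl

lastOne-unique : ∀ a {k} b {j} → a ++ 𝟙 ∷ 0^ k ≡ b ++ 𝟙 ∷ 0^ j → a ≡ b × k ≡ j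
lastOne-unique []      {k} []      {j} eq = refl , 0^-injective k j (∷-injectiveʳ eq)
lastOne-unique []      {k} (c ∷ b) eq = ⊥-elim (0^-no-𝟙 k b (∷-injectiveʳ eq))
lastOne-unique (c ∷ a) []      {j} eq = ⊥-elim (0^-no-𝟙 j a (sym (∷-injectiveʳ eq)))
lastOne-unique (c ∷ a) (d ∷ b) eq with refl ← cong (take 1) eq | refl , refl ← lastOne-unique a b (∷-injectiveʳ eq)
  = refl , refl

-- The condition `followed` on what comes after a movable subpath. Paths from height 0 satisfy it
-- too, so runs of zeros in front of either can be compared.
data Rising : Word → Set where
  empty : Rising []
  rise  : ∀ b → Rising (𝟙 ∷ b)

Rising-++ : ∀ b {e s t} → Rising (b ++ e ∷ s) → Rising (b ++ e ∷ t)
Rising-++ []      (rise _) = rise _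
Rising-++ (𝟙 ∷ b) (rise _) = rise _

Path-Rising : ∀ {w l} → Path 0 w l → Rising w
Path-Rising nil    = empty
Path-Rising (up p) = rise _

0^-Rising : ∀ j k {b r} → 0^ j ++ b ≡ 0^ k ++ r → Rising b → Rising r → j ≡ k × b ≡ r
0^-Rising zero    zero    eq   _ _ = refl , eq
0^-Rising (suc j) zero    refl _ ()
0^-Rising zero    (suc k) refl () _
0^-Rising (suc j) (suc k) eq   B R with refl , refl ← 0^-Rising j k (∷-injectiveʳ eq) B R
  = refl , refl

-- First passages and surgery on paths.

Path-end : ∀ {h w l l′} → Path h w l → Path h w l′ → l ≡ l′
Path-end nil      nil      = refl
Path-end (up p)   (up q)   = Path-end p q
Path-end (down p) (down q) = Path-end p q

0^-Path : ∀ k {l} → Path (k + l) (0^ k) l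
0^-Path zero    = nil
0^-Path (suc k) = down (0^-Path k)

0^-descent : ∀ k → Path k (0^ k) 0
0^-descent k = subst (λ h → Path h (0^ k) 0) (ℕ.+-identityʳ k) (0^-Path k)

-- `k` acts as a floor: either `s` never falls through it and may be lowered by `k`, or `q` ends
-- just before the first fall. This decides on which side of a first return a moved block lies.
firstPassage : ∀ h k s {l} → Path (h + k) s l →
  (∃[ l′ ] l ≡ l′ + k × Path h s l′) ⊎
  (∃[ k′ ] ∃[ q ] ∃[ r ] k ≡ suc k′ × s ≡ q ++ 𝟘 ∷ r × Path h q 0 × Path k′ r l)
firstPassage h       k []      nil      = inj₁ (h , refl , nil)
firstPassage h       k (𝟙 ∷ s) (up p) with firstPassage (suc h) k s p
... | inj₁ (l′ , eq , p′)                     = inj₁ (l′ , eq , up p′)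
... | inj₂ (k′ , q , r , refl , refl , p₁ , p₂) = inj₂ (k′ , 𝟙 ∷ q , r , refl , refl , up p₁ , p₂)
firstPassage zero    k (𝟘 ∷ s) (down p) = inj₂ (_ , [] , s , refl , refl , nil , p)
firstPassage (suc h) k (𝟘 ∷ s) (down p) with firstPassage h k s p
... | inj₁ (l′ , eq , p′)                     = inj₁ (l′ , eq , down p′)
... | inj₂ (k′ , q , r , refl , refl , p₁ , p₂) = inj₂ (k′ , 𝟘 ∷ q , r , refl , refl , down p₁ , p₂)

-- The first fall below height 0 is a position that the word and `h` determine.
firstPassage-unique : ∀ {h p q s t} → Path h p 0 → Path h q 0 →
                      p ++ 𝟘 ∷ s ≡ q ++ 𝟘 ∷ t → p ≡ q × s ≡ t
firstPassage-unique nil      nil      eq = refl , ∷-injectiveʳ eq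
firstPassage-unique nil      (up Q)   ()
firstPassage-unique (up P)   nil      ()
firstPassage-unique (up P)   (up Q)   eq with refl , refl ← firstPassage-unique P Q (∷-injectiveʳ eq)
  = refl , refl
firstPassage-unique (down P) (down Q) eq with refl , refl ← firstPassage-unique P Q (∷-injectiveʳ eq)
  = refl , refl

-- A path from height `j` cannot descend `n > j` zeros, so `e` ends inside the run.
0^-dominates : ∀ {j e l s r} n → Path j e l → e ++ s ≡ 0^ n ++ r → j < n →
            ∃[ p ] ∃[ n′ ] e ≡ 0^ p × j ≡ p + l × n ≡ p + n′ × s ≡ 0^ n′ ++ r
0^-dominates n       nil      eq j<n       = 0 , n , refl , refl , refl , eq
0^-dominates (suc n) (up P)   () j<n
0^-dominates (suc n) (down P) eq (s≤s j<n) with 0^-dominates n P (∷-injectiveʳ eq) j<n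
... | p , n′ , refl , refl , refl , eq′ = suc p , n′ , refl , refl , refl , eq′

-- The heights around `q` stay the same when another Dyck word replaces it. This inserts the right
-- factor's `q` into a block of the left factor, or cuts it out.
replace-factor : ∀ d {y q q′ s} → 𝟙 ∷ y ≡ d ++ 𝟙 ∷ q ++ s →
                 Path 0 q 0 → Path 0 q′ 0 → Path 0 y 0 →
                 ∃[ y′ ] 𝟙 ∷ y′ ≡ d ++ 𝟙 ∷ q′ ++ s × Path 0 y′ 0
replace-factor []      {q = q} refl Q Q′ Y with j , Q₀ , S ← split q Y with refl ← Path-end Q Q₀
  = _ , refl , Q′ ⋆ S
replace-factor (𝟙 ∷ d) {q = q} refl Q Q′ Y with j , D , up QS ← split d Y with l , Q₀ , S ← split q QS
  with refl ← Path-end (shift (suc j) Q) Q₀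
  = _ , refl , D ⋆ up (shift (suc j) Q′ ⋆ S)

-- Zeros ending `1 y` join those after it: `m = 1` closes the block before its move, `m = i + 2`
-- includes the crossed zeros after it.
absorb : ∀ d {y q r j k} m → 𝟙 ∷ y ≡ d ++ 𝟙 ∷ q ++ 0^ j → j + m ≡ k →
         𝟙 ∷ y ++ 0^ m ++ r ≡ d ++ 𝟙 ∷ q ++ 0^ k ++ r
absorb d {y} {q} {r} {j} m eq refl = begin
  (𝟙 ∷ y) ++ 0^ m ++ r                   ≡⟨ cong (_++ 0^ m ++ r) eq ⟩
  (d ++ 𝟙 ∷ q ++ 0^ j) ++ 0^ m ++ r      ≡⟨ reassoc d (reassoc (𝟙 ∷ q) (sym (0^-+ j m))) ⟩
  d ++ 𝟙 ∷ q ++ 0^ (j + m) ++ r          ∎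
  where open ≡-Reasoning

absorb₀ : ∀ d {y j k} m → 𝟙 ∷ y ≡ d ++ 𝟙 ∷ 0^ j → j + m ≡ k →
          𝟙 ∷ y ++ 0^ m ++ [] ≡ d ++ 𝟙 ∷ 0^ k
absorb₀ d {k = k} m eq eq′ =
  trans (absorb d m eq eq′) (cong (λ t → d ++ 𝟙 ∷ t) (++-identityʳ (0^ k)))

beforeLastOne-Path : ∀ d {j w} → w ≡ d ++ 𝟙 ∷ 0^ j → Path 0 w 1 → Path 0 d j
beforeLastOne-Path d {j} eq W with h , D , up Z ← split d (subst (λ w → Path 0 w 1) eq W)
  = subst (Path 0 d) (ℕ.suc-injective (trans (zeros-Path j Z) (ℕ.+-comm j 1))) D

-- Moves of blocks as steps between words.

-- An edge w ⟶ w′ moving the block x = 1 y 0 past i + 1 zeros.  c may end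
-- with zeros, so all i + 1 ≤ N are covered.
data Step (w w′ : Word) : Set where
  step : ∀ c i y b →
         w  ≡ c ++ 0^ (suc i) ++ 𝟙 ∷ y ++ 𝟘 ∷ b →
         w′ ≡ c ++ 𝟙 ∷ y ++ 0^ (suc (suc i)) ++ b →
         Path 0 y 0 → Rising b → Step w w′

-- Lowering the block is safe: its new base is a height that the path already attains after the
-- crossed zeros.
slideʳ : ∀ c i {y b h l} → Path 0 y 0 →
         Path h (c ++ 𝟙 ∷ y ++ 0^ (suc (suc i)) ++ b) l →
         Path h (c ++ 0^ (suc i) ++ 𝟙 ∷ y ++ 𝟘 ∷ b) l
slideʳ c i {y} Y P with split c P
... | j , C , up P′ with split y P′
... | j′ , Y′ , P″ with refl ← Path-end (shift (suc j) Y) Y′ | down P‴ ← P″ with split (0^ (suc i)) P‴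
... | j″ , Z , B = C ⋆ Z ⋆ up (shift (suc j″) Y ⋆ down B)

slideˡ : ∀ c i {y b h l} → Path 0 y 0 →
         Path h (c ++ 0^ (suc i) ++ 𝟙 ∷ y ++ 𝟘 ∷ b) l →
         Path h (c ++ 𝟙 ∷ y ++ 0^ (suc (suc i)) ++ b) l
slideˡ c i {y} Y P with split c P
... | j , C , P′ with split (0^ (suc i)) P′
... | j′ , Z , up P″ with split y P″
... | j″ , Y′ , P‴ with refl ← Path-end (shift (suc j′) Y) Y′ | down B ← P‴
  = C ⋆ up (shift (suc j) Y ⋆ down (Z ⋆ B))

-- The product as a relation, and steps lifted from its factors.

-- w = u ♯ v, where k + 1 is the height reached after the last 1 of u.
data Factor (u v w : Word) : Set where
  factor : ∀ a k q r →
           u ≡ a ++ 𝟙 ∷ 0^ (suc k) →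
           v ≡ 𝟙 ∷ q ++ 𝟘 ∷ r →
           w ≡ a ++ 𝟙 ∷ q ++ 0^ (suc k) ++ r →
           Path 0 a k → Path 0 q 0 → Path 0 r 0 → Factor u v w

-- If a `1` follows the block, the move takes place inside `a`. Otherwise the block contains the
-- last `1` of `u`, and in `w` it carries `q` along.
Factor-stepˡ : ∀ {u u′ v w} → Factor u v w → Step u u′ → ∃[ w′ ] Factor u′ v w′ × Step w w′
Factor-stepˡ (factor a k q r refl refl refl A Q R) (step c i y (𝟙 ∷ b) eq refl Y (rise _))
  with b₁ , j , eqb ← lastOne b
  rewrite eqb
  with refl , refl ← lastOne-unique a (c ++ 0^ (suc i) ++ 𝟙 ∷ y ++ 𝟘 ∷ b₁)
         (trans eq (sym (reassoc c (reassoc (0^ (suc i)) (reassoc (𝟙 ∷ y) refl)))))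
  = _
  , factor (c ++ 𝟙 ∷ y ++ 0^ (suc (suc i)) ++ b₁) k q r
      (sym (reassoc c (reassoc (𝟙 ∷ y) (reassoc (0^ (suc (suc i))) refl))))
      refl refl (slideˡ c i Y A) Q R
  , step c i y (b₁ ++ 𝟙 ∷ q ++ 0^ (suc k) ++ r)
      (reassoc c (reassoc (0^ (suc i)) (reassoc (𝟙 ∷ y) refl)))
      (reassoc c (reassoc (𝟙 ∷ y) (reassoc (0^ (suc (suc i))) refl)))
      Y (Rising-++ b₁ (subst Rising eqb (rise b)))
Factor-stepˡ (factor a k q r refl refl refl A Q R) (step c i y [] eq refl Y empty)
  with d , j , eqy ← lastOne y
  with refl , refl ← lastOne-unique a {suc k} (c ++ 0^ (suc i) ++ d) {suc j}
         (trans eq (sym (reassoc c (reassoc (0^ (suc i)) (sym (absorb₀ d 1 eqy (ℕ.+-comm j 1)))))))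
  with h , C , A′ ← split c A
  with l , Z , D ← split (0^ (suc i)) A′
  with refl ← zeros-Path (suc i) Z
  with D′ ← beforeLastOne-Path d {j} eqy (up (shift 1 Y))
  -- `d` ends at height `j` from base 0 and from base `l`, so the block stands at height 0.
  with refl ← ℕ.+-cancelˡ-≡ j 0 l (trans (ℕ.+-identityʳ j) (Path-end D (shift l D′)))
  with y′ , eqy′ , Y′ ← replace-factor d eqy nil Q Y
  = _
  -- The crossed zeros now come after the last `1`, whose height grows by `i + 1`.
  , factor (c ++ d) (j + suc i) q r
      (trans (cong (c ++_) (absorb₀ d (suc (suc i)) eqy (ℕ.+-suc j (suc i)))) (sym (++-assoc c d _)))
      refl refl
      (subst (Path 0 (c ++ d)) (cong (λ t → j + suc t) (ℕ.+-identityʳ i)) (C ⋆ shift _ D′)) Q R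
  , step c i y′ r
      (reassoc c (reassoc (0^ (suc i)) (sym (absorb d 1 eqy′ (ℕ.+-comm j 1)))))
      (reassoc c (sym (absorb d (suc (suc i)) eqy′ (ℕ.+-suc j (suc i)))))
      Y′ (Path-Rising R)

-- The move lies after the first return of `v` to 0, across it, or before it.
Factor-stepʳ : ∀ {u v v′ w} → Factor u v w → Step v v′ → ∃[ w′ ] Factor u v′ w′ × Step w w′
Factor-stepʳ (factor a k q r refl refl refl A Q R) (step [] i y b () refl Y B)
Factor-stepʳ (factor a k q r refl refl refl A Q R) (step (𝟘 ∷ c) i y b () refl Y B)
Factor-stepʳ (factor a k q r refl refl refl A Q R) (step (𝟙 ∷ c) i y b eq refl Y B)
  with h , C , P ← split c (subst (λ w → Path 1 w 0) (∷-injectiveʳ eq) (shift 1 Q ⋆ down R))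
  with firstPassage 0 1 c C
... | inj₂ (_ , q₁ , c′ , refl , refl , Q₁ , C′)
  with refl , refl ← firstPassage-unique Q Q₁ (trans (∷-injectiveʳ eq) (++-assoc q₁ _ _))
  = _
  , factor a k q (c′ ++ 𝟙 ∷ y ++ 0^ (suc (suc i)) ++ b) refl (cong (𝟙 ∷_) (++-assoc q _ _)) refl
      A Q (slideˡ c′ i Y R)
  , step (a ++ 𝟙 ∷ q ++ 0^ (suc k) ++ c′) i y b
      (sym (reassoc a (reassoc (𝟙 ∷ q) (reassoc (0^ (suc k)) refl))))
      (sym (reassoc a (reassoc (𝟙 ∷ q) (reassoc (0^ (suc k)) refl))))
      Y B
... | inj₁ (l , refl , C′)
  with j , Z , P′ ← split (0^ (suc i)) P
  with j | zeros-Path (suc i) Z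
-- The last crossed zero is the first return itself, so the block passes from `r` into `q`.
... | zero | l+1≡
  with refl ← ℕ.suc-injective (trans (ℕ.+-comm 1 l) l+1≡)
  with refl , refl ← firstPassage-unique Q (C′ ⋆ 0^-Path i)
                       (trans (∷-injectiveʳ eq) (sym (reassoc c (0^-∷ i))))
  with up P″ ← P′
  with h , Y′ , P‴ ← split y P″
  with refl ← Path-end (shift 1 Y) Y′ | down R′ ← P‴
  = _
  , factor a k (c ++ 𝟙 ∷ y ++ 𝟘 ∷ 0^ i) b refl
      (cong (𝟙 ∷_) (sym (reassoc c (reassoc (𝟙 ∷ y) (cong (𝟘 ∷_) (0^-∷ i))))))
      refl A (C′ ⋆ up (shift (suc (i + 0)) Y ⋆ down (0^-Path i))) R′
  -- In `w` there are `k + 1` zeros in place of the one return of `v`, and the block crosses all of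
  -- them.
  , step (a ++ 𝟙 ∷ c) (i + k) y b
      (trans (cong (λ t → a ++ 𝟙 ∷ t) (reassoc c (sym (0^-+-suc i k))))
        (sym (++-assoc a (𝟙 ∷ c) _)))
      (trans (cong (λ t → a ++ 𝟙 ∷ t) (reassoc c (reassoc (𝟙 ∷ y) (cong (𝟘 ∷_) (sym (0^-+-suc i k))))))
        (sym (++-assoc a (𝟙 ∷ c) _)))
      Y B
-- The block starts above height 0, so the first return comes later, in `b`.
... | suc j | l+1≡
  with refl ← ℕ.suc-injective (trans (ℕ.+-comm 1 l) (trans l+1≡ (ℕ.+-suc (suc i) j)))
  with up P″ ← P′
  with h , Y′ , P‴ ← split y P″
  with refl ← Path-end (shift (suc (suc j)) Y) Y′ | down B′ ← P‴
  with firstPassage j 1 b (subst (λ t → Path t b 0) (ℕ.+-comm 1 j) B′)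
... | inj₁ (l′ , 0≡l′+1 , _) = ⊥-elim (ℕ.0≢1+n (trans 0≡l′+1 (ℕ.+-comm l′ 1)))
... | inj₂ (_ , b₁ , b₂ , refl , refl , B₁ , B₂)
  with Q′ ← C′ ⋆ 0^-Path (suc i) ⋆ up (shift (suc j) Y ⋆ down B₁)
  with refl , refl ← firstPassage-unique Q Q′
         (trans (∷-injectiveʳ eq) (sym (reassoc c (reassoc (0^ (suc i)) (reassoc (𝟙 ∷ y) refl)))))
  = _
  , factor a k (c ++ 𝟙 ∷ y ++ 0^ (suc (suc i)) ++ b₁) b₂ refl
      (cong (𝟙 ∷_) (sym (reassoc c (reassoc (𝟙 ∷ y) (reassoc (0^ (suc (suc i))) refl)))))
      refl A (slideˡ c i Y Q′) B₂
  , step (a ++ 𝟙 ∷ c) i y (b₁ ++ 0^ (suc k) ++ b₂)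
      (trans (cong (λ t → a ++ 𝟙 ∷ t) (reassoc c (reassoc (0^ (suc i)) (reassoc (𝟙 ∷ y) refl))))
        (sym (++-assoc a (𝟙 ∷ c) _)))
      (trans (cong (λ t → a ++ 𝟙 ∷ t) (reassoc c (reassoc (𝟙 ∷ y) (reassoc (0^ (suc (suc i))) refl))))
        (sym (++-assoc a (𝟙 ∷ c) _)))
      Y (Rising-++ b₁ B)

-- Steps that end in a product.

fall-Path : ∀ k {q r} → Path 0 q 0 → Path 0 r 0 → Path k (q ++ 0^ k ++ r) 0
fall-Path k Q R =
  shift k Q ⋆ 0^-descent k ⋆ R

0^-positive : ∀ i {h b l} → Path (suc h) (0^ (suc (suc i)) ++ b) l → 1 ≤ h
0^-positive i (down (down P)) = s≤s z≤n

-- The moved block 1 y 0 = d 1 e 0 contains the last 1 of the left factor: since b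
-- and r do not start with 0, the run 0ᵏ⁺¹ after q must end exactly where the moved zeros end.
overlap-shape : ∀ i {j h q r e b} → Path 0 q 0 → Path (suc j) e 1 → Rising b → Rising r → 1 ≤ h →
          q ++ 0^ (suc (j + h)) ++ r ≡ e ++ 0^ (suc (suc i)) ++ b →
          e ≡ q ++ 0^ j × j + h ≡ j + suc i × b ≡ r
overlap-shape i {j} {h} {q} {e = e} Q E B R 1≤h eq with firstPassage 0 (suc j) e E
... | inj₁ (zero , refl , E₀)
  with refl , eq′ ← firstPassage-unique Q E₀ eq
  with refl , refl ← 0^-Rising h (suc i) eq′ R B
  = sym (++-identityʳ q) , refl , refl
... | inj₁ (suc l , 1≡ , _) = ⊥-elim (ℕ.0≢1+n (trans (ℕ.suc-injective 1≡) (ℕ.+-suc l j)))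
... | inj₂ (_ , q₁ , e₁ , refl , refl , Q₁ , E₁)
  with refl , eq′ ← firstPassage-unique Q Q₁ (trans eq (++-assoc q₁ _ _))
  -- `1 ≤ h` makes the run longer than the height `j` from which `e₁` starts.
  with p , n , refl , refl , p+1+h≡p+n , eq″ ←
         0^-dominates (j + h) E₁ (sym eq′) (ℕ.m<m+n j 1≤h)
  with refl , refl ← 0^-Rising (suc (suc i)) n eq″ B R
  = cong (λ t → q ++ 0^ t) (ℕ.+-comm 1 p) , trans p+1+h≡p+n (sym (ℕ.+-assoc p 1 (suc i))) , refl

StepPair : Word → Word → Word → Word → Set
StepPair u v u′ v′ = (Step u u′ × v ≡ v′) ⊎ (u ≡ u′ × Step v v′)

-- The last `1` of `u′` is located relative to the moved block. After the block or inside it, the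
-- step comes from the left factor; before the block, from the right one.
Factor-unstep : ∀ {u′ v′ w w′} → Factor u′ v′ w′ → Step w w′ →
                ∃[ u ] ∃[ v ] Factor u v w × StepPair u v u′ v′
Factor-unstep (factor a k q r refl refl refl A Q R) (step c i y b refl eq Y B)
  with locate c a (sym eq)
... | inj₁ (d , refl , eq₁) with locate (𝟙 ∷ y) d eq₁
...   | inj₁ (d₂ , refl , eq₂) with locate (0^ (suc (suc i))) d₂ eq₂
...     | inj₂ (e , eq₃ , _) = ⊥-elim (0^-no-𝟙 (suc (suc i)) d₂ eq₃)
...     | inj₁ (b₁ , refl , refl)
  = _ , _
  , factor (c ++ 0^ (suc i) ++ 𝟙 ∷ y ++ 𝟘 ∷ b₁) k q r refl refl
      (sym (reassoc c (reassoc (0^ (suc i)) (reassoc (𝟙 ∷ y) refl))))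
      (slideʳ c i Y A) Q R
  , inj₁ (step c i y (b₁ ++ 𝟙 ∷ 0^ (suc k))
            (reassoc c (reassoc (0^ (suc i)) (reassoc (𝟙 ∷ y) refl)))
            (reassoc c (reassoc (𝟙 ∷ y) (reassoc (0^ (suc (suc i))) refl)))
            Y (Rising-++ b₁ B)
         , refl)
Factor-unstep (factor a k q r refl refl refl A Q R) (step c i y b refl eq Y B)
      | inj₁ (d , refl , eq₁) | inj₂ (e , eqe , eqt)
  with h , C , D ← split c A
  with j , D₀ , up E ← split d (subst (λ w → Path 0 w 1) eqe (up (shift 1 Y)))
  with refl ← Path-end D (shift h D₀)
  with _ , E₁ , P ← split e (subst (λ w → Path (suc (j + h)) w 0) eqt (fall-Path (suc (j + h)) Q R))
  with refl ← Path-end (shift h E) E₁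
  with refl , j+h≡ , refl ← overlap-shape i Q E B (Path-Rising R) (0^-positive i P) eqt
  -- `c` ends at height `i + 1`, so in the left factor the crossed zeros lead down to 0 and the
  -- block, with `q` cut out, is final.
  with refl ← ℕ.+-cancelˡ-≡ j h (suc i) j+h≡
  with y′ , eqy′ , Y′ ← replace-factor d eqe Q nil Y
  = _ , _
  , factor (c ++ 0^ (suc i) ++ d) j q r refl refl
      (sym (reassoc c (reassoc (0^ (suc i)) (sym (absorb d 1 eqe (ℕ.+-comm j 1))))))
      (C ⋆ 0^-descent (suc i) ⋆ D₀) Q R
  , inj₁ (step c i y′ []
            (reassoc c (reassoc (0^ (suc i)) (sym (absorb₀ d 1 eqy′ (ℕ.+-comm j 1)))))
            (reassoc c (sym (absorb₀ d (suc (suc i)) eqy′ (ℕ.+-suc j (suc i)))))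
            Y′ empty
         , refl)
Factor-unstep (factor a k q r refl refl refl A Q R) (step c i y b refl eq Y B)
      | inj₂ (c₁ , refl , eqt)
  with h , C , up P ← split c₁ (subst (λ w → Path (suc k) w 0) eqt (fall-Path (suc k) Q R))
  with _ , Y₁ , P′ ← split y P
  with refl ← Path-end (shift (suc h) Y) Y₁ | down P″ ← P′
  with j , Z , B′ ← split (0^ (suc i)) P″
  with firstPassage 0 (suc k) c₁ C
... | inj₂ (_ , q₁ , c₂ , refl , refl , Q₁ , C₂)
  with refl , eqr ← firstPassage-unique Q Q₁ (trans eqt (++-assoc q₁ _ _))
  -- The block begins with `1`, hence after the remaining `k` zeros, inside `r`.
  with locate (0^ k) c₂ eqr
... | inj₂ (_ , eqz , _) = ⊥-elim (0^-no-𝟙 k c₂ eqz)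
... | inj₁ (c₃ , refl , refl)
  = _ , _
  , factor a k q (c₃ ++ 0^ (suc i) ++ 𝟙 ∷ y ++ 𝟘 ∷ b) refl refl
      (reassoc a (reassoc (𝟙 ∷ q) (reassoc (0^ (suc k)) refl)))
      A Q (slideʳ c₃ i Y R)
  , inj₂ (refl , step (𝟙 ∷ q ++ 𝟘 ∷ c₃) i y b
                   (sym (reassoc (𝟙 ∷ q) refl)) (sym (reassoc (𝟙 ∷ q) refl)) Y B)
Factor-unstep (factor a k q r refl refl refl A Q R) (step c i y b refl eq Y B)
      | inj₂ (c₁ , refl , eqt) | inj₁ (l , refl , C′)
  -- `l` is the height of the block above the floor `k + 1`; the crossed zeros fall through the
  -- floor exactly when `l ≤ i`.
  with ℕ.<-≤-connex i l
... | inj₂ l≤i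
  with n , refl ← ℕ.m≤n⇒∃[o]m+o≡n l≤i
  with Q₁ ← C′ ⋆ up (shift (suc l) Y ⋆ down (0^-descent l))
  with refl , eqr ← firstPassage-unique Q Q₁
         (trans eqt (sym (reassoc c₁ (reassoc (𝟙 ∷ y) (cong (𝟘 ∷_) (trans (0^-∷ l) (cong (𝟘 ∷_) (sym (0^-+ l n)))))))))
  -- Neither `r` nor `b` begins with `0`, so a run that falls through the floor contains all `k + 1`
  -- zeros between `q` and `r`.
  with refl , refl ← 0^-Rising k n eqr (Path-Rising R) B
  = _ , _
  , factor a k (c₁ ++ 0^ l) (𝟙 ∷ y ++ 𝟘 ∷ b) refl refl
      (reassoc a (cong (𝟙 ∷_) (sym (reassoc c₁ (sym (0^-+-suc l k))))))
      A (C′ ⋆ 0^-descent l)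
      (up (shift 1 Y ⋆ down R))
  , inj₂ (refl , step (𝟙 ∷ c₁) l y b
                   (cong (𝟙 ∷_) (reassoc c₁ (0^-∷ l)))
                   (cong (𝟙 ∷_) (reassoc c₁ (reassoc (𝟙 ∷ y) (cong (𝟘 ∷_) (0^-∷ l)))))
                   Y B)
... | inj₁ i<l
  with n , refl ← ℕ.m≤n⇒∃[o]m+o≡n i<l
  with refl ← ℕ.+-cancelˡ-≡ (suc i) j (n + suc k)
                (trans (sym (zeros-Path (suc i) Z)) (ℕ.+-assoc (suc i) n (suc k)))
  with firstPassage n (suc k) b B′
... | inj₁ (l′ , 0≡ , _) = ⊥-elim (ℕ.0≢1+n (trans 0≡ (ℕ.+-suc l′ k)))
... | inj₂ (_ , b₁ , b₂ , refl , refl , B₁ , B₂)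
  with Q₁ ← C′ ⋆ 0^-Path (suc i) ⋆ up (shift (suc n) Y ⋆ down B₁)
  with refl , refl ← firstPassage-unique Q (slideˡ c₁ i Y Q₁)
         (trans eqt (sym (reassoc c₁ (reassoc (𝟙 ∷ y) (reassoc (0^ (suc (suc i))) refl)))))
  = _ , _
  , factor a k (c₁ ++ 0^ (suc i) ++ 𝟙 ∷ y ++ 𝟘 ∷ b₁) r refl refl
      (reassoc a (cong (𝟙 ∷_) (sym (reassoc c₁ (reassoc (0^ (suc i)) (reassoc (𝟙 ∷ y) refl))))))
      A Q₁ R
  , inj₂ (refl , step (𝟙 ∷ c₁) i y (b₁ ++ 𝟘 ∷ r)
                   (cong (𝟙 ∷_) (reassoc c₁ (reassoc (0^ (suc i)) (reassoc (𝟙 ∷ y) refl))))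
                   (cong (𝟙 ∷_) (reassoc c₁ (reassoc (𝟙 ∷ y) (reassoc (0^ (suc (suc i))) refl))))
                   Y (Rising-++ b₁ B))

-- Uniqueness of products and of factors.

#𝟙-0^ : ∀ k w → # 𝟙 (0^ k ++ w) ≡ # 𝟙 w
#𝟙-0^ zero    w = refl
#𝟙-0^ (suc k) w = #𝟙-0^ k w

prefix-unique : ∀ a {s} b {t} → a ++ 𝟙 ∷ s ≡ b ++ 𝟙 ∷ t → # 𝟙 a ≡ # 𝟙 b → a ≡ b × s ≡ t
prefix-unique []      []      eq n = refl , ∷-injectiveʳ eq
prefix-unique []      (𝟘 ∷ b) () n
prefix-unique []      (𝟙 ∷ b) eq ()
prefix-unique (𝟘 ∷ a) []      () n
prefix-unique (𝟙 ∷ a) []      eq ()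
prefix-unique (𝟘 ∷ a) (𝟙 ∷ b) () n
prefix-unique (𝟙 ∷ a) (𝟘 ∷ b) () n
prefix-unique (𝟘 ∷ a) (𝟘 ∷ b) eq n
  with refl , refl ← prefix-unique a b (∷-injectiveʳ eq) n = refl , refl
prefix-unique (𝟙 ∷ a) (𝟙 ∷ b) eq n
  with refl , refl ← prefix-unique a b (∷-injectiveʳ eq) (ℕ.suc-injective n) = refl , refl

#𝟙-left : ∀ a k → # 𝟙 (a ++ 𝟙 ∷ 0^ k) ≡ suc (# 𝟙 a)
#𝟙-left a k = begin
  # 𝟙 (a ++ 𝟙 ∷ 0^ k)        ≡⟨ #-++ 𝟙 a (𝟙 ∷ 0^ k) ⟩
  # 𝟙 a + suc (# 𝟙 (0^ k))   ≡⟨ ℕ.+-suc (# 𝟙 a) _ ⟩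
  suc (# 𝟙 a + # 𝟙 (0^ k))   ≡⟨ cong (λ w → suc (# 𝟙 a + # 𝟙 w)) (sym (++-identityʳ (0^ k))) ⟩
  suc (# 𝟙 a + # 𝟙 (0^ k ++ [])) ≡⟨ cong (λ t → suc (# 𝟙 a + t)) (#𝟙-0^ k []) ⟩
  suc (# 𝟙 a + 0)            ≡⟨ cong suc (ℕ.+-identityʳ (# 𝟙 a)) ⟩
  suc (# 𝟙 a)                ∎
  where open ≡-Reasoning

-- The last `1` of `u` and the first return of `v` fix all four parts. This identifies the words
-- produced by lifted steps with actual products.
Factor-functional : ∀ {u v w w′} → Factor u v w → Factor u v w′ → w ≡ w′
Factor-functional (factor a k q r eqa refl refl A Q R) (factor a′ k′ q′ r′ refl eqv refl A′ Q′ R′)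
  with refl , refl ← lastOne-unique a′ a eqa
     | refl , refl ← firstPassage-unique Q Q′ (∷-injectiveʳ eqv) = refl

-- The count of 1's locates the end of `a` in `w`; its height is `k`, a first passage gives `q`, and
-- `r` is what remains.
Factor-injective : ∀ {u v u′ v′ w} → Factor u v w → Factor u′ v′ w →
                   # 𝟙 u ≡ # 𝟙 u′ → u ≡ u′ × v ≡ v′
Factor-injective (factor a k q r refl refl refl A Q R) (factor a′ k′ q′ r′ refl refl eq A′ Q′ R′) n
  with refl , eq₁ ← prefix-unique a a′ eq
         (ℕ.suc-injective (trans (sym (#𝟙-left a (suc k))) (trans n (#𝟙-left a′ (suc k′)))))
  with refl ← Path-end A A′
  with refl , eq₂ ← firstPassage-unique Q Q′ eq₁
  with refl ← ++-cancelˡ (0^ k) r r′ eq₂ = refl , refl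

-- The product of words satisfies the relation.

stripZeros-𝟙 : ∀ p → ∃[ a ] 𝟙 ∷ proj₁ (stripZeros p) ≡ a ++ [ 𝟙 ]
stripZeros-𝟙 p with stripZeros-last p
... | inj₁ eq       = [] , cong (𝟙 ∷_) eq
... | inj₂ (r , eq) = 𝟙 ∷ r , cong (𝟙 ∷_) eq

cut-rest : ∀ h q → proj₂ (cut h q) ≡ [] ⊎ ∃[ r ] proj₂ (cut h q) ≡ 𝟘 ∷ r
cut-rest h       []      = inj₁ refl
cut-rest h       (𝟙 ∷ q) = cut-rest (suc h) q
cut-rest zero    (𝟘 ∷ q) = inj₂ (q , refl)
cut-rest (suc h) (𝟘 ∷ q) = cut-rest h q

-- The first return to 0 is the first letter of the rest or, if the rest is empty, the closing `0`.
rest-Path : ∀ {q} → q ≡ [] ⊎ ∃[ r ] q ≡ 𝟘 ∷ r → Path 1 q 1 → ∃[ r ] q ++ [ 𝟘 ] ≡ 𝟘 ∷ r × Path 0 r 0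
rest-Path (inj₁ refl)       nil      = [] , refl , nil
rest-Path (inj₂ (r , refl)) (down R) = r ++ [ 𝟘 ] , refl , R ⋆ down nil

-- In `1 p′ q′ 0ᵏ q″ 0` the first return of the right factor completes `0ᵏ` to the `k + 1` zeros
-- that end the left factor.
∗-Factor : ∀ p q → Path 1 p 1 → Path 1 q 1 →
           Factor (𝟙 ∷ p ++ [ 𝟘 ]) (𝟙 ∷ q ++ [ 𝟘 ]) (𝟙 ∷ (p ∗ q) ++ [ 𝟘 ])
∗-Factor p q P Q
  with stripZeros p | stripZeros-++ p | stripZeros-𝟙 p | cut 0 q | cut-++ 0 q | cut-rest 0 q | cut-Path 0 q Q
... | p′ , k | refl | a , eqa | q′ , q″ | refl | rest | Q′ , Q″
  with r , eqr , R ← rest-Path rest Q″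
  = factor a k q′ r
      (trans (cong (_++ [ 𝟘 ]) head) (reassoc a (cong (𝟙 ∷_) (trans (0^-∷ k) (cong (𝟘 ∷_) (++-identityʳ _))))))
      (cong (𝟙 ∷_) (reassoc q′ eqr))
      (begin
        ((𝟙 ∷ p′) ++ q′ ++ 0^ k ++ q″) ++ [ 𝟘 ]  ≡⟨ reassoc (𝟙 ∷ p′) (reassoc q′ (reassoc (0^ k) eqr)) ⟩
        (𝟙 ∷ p′) ++ q′ ++ 0^ k ++ 𝟘 ∷ r          ≡⟨ cong₂ (λ s t → s ++ q′ ++ t) eqa (0^-∷ k) ⟩
        (a ++ [ 𝟙 ]) ++ q′ ++ 0^ (suc k) ++ r    ≡⟨ ++-assoc a [ 𝟙 ] _ ⟩
        a ++ 𝟙 ∷ q′ ++ 0^ (suc k) ++ r           ∎)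
      (beforeLastOne-Path a head (up P)) Q′ R
  where
  open ≡-Reasoning
  head : 𝟙 ∷ p′ ++ 0^ k ≡ a ++ 𝟙 ∷ 0^ k
  head = trans (cong (_++ 0^ k) eqa) (++-assoc a [ 𝟙 ] _)

-- Heights, and subpaths as blocks `1 y 0`.

height-++ : ∀ a x k → height (a ++ x) ≡ (k + # 𝟙 x + # 𝟙 a) ℤ.⊖ (k + # 𝟘 x + # 𝟘 a)
height-++ a x k
  rewrite #-++ 𝟙 a x | #-++ 𝟘 a x | ℕ.+-comm (# 𝟙 a) (# 𝟙 x) | ℕ.+-comm (# 𝟘 a) (# 𝟘 x)
        | ℕ.+-assoc k (# 𝟙 x) (# 𝟙 a) | ℕ.+-assoc k (# 𝟘 x) (# 𝟘 a)
  = sym (ℤ.+-cancelˡ-⊖ k _ _)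

height-level : ∀ a x → # 𝟙 x ≡ # 𝟘 x → height (a ++ x) ≡ height a
height-level a x eq
  rewrite height-++ a x 0 | eq = ℤ.+-cancelˡ-⊖ (# 𝟘 x) (# 𝟙 a) (# 𝟘 a)

height-climb : ∀ a x → # 𝟘 x < # 𝟙 x → height a ℤ.< height (a ++ x)
height-climb a x lt
  rewrite height-++ a x 0 | sym (ℤ.+-cancelˡ-⊖ (# 𝟙 x) (# 𝟙 a) (# 𝟘 a))
  = ℤ.⊖-monoʳ->-< (# 𝟙 x + # 𝟙 a) (ℕ.+-monoˡ-< (# 𝟘 a) lt)

height-fall : ∀ a x → # 𝟙 x < # 𝟘 x → height (a ++ x) ℤ.< height a
height-fall a x lt
  rewrite height-++ a x 0 | sym (ℤ.+-cancelˡ-⊖ (# 𝟙 x) (# 𝟙 a) (# 𝟘 a))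
  = ℤ.⊖-monoʳ->-< (# 𝟙 x + # 𝟙 a) (ℕ.+-monoˡ-< (# 𝟘 a) lt)

height-level⁻ : ∀ a x → height (a ++ x) ≡ height a → # 𝟙 x ≡ # 𝟘 x
height-level⁻ a x eq with ℕ.<-cmp (# 𝟙 x) (# 𝟘 x)
... | tri< lt _ _ = ⊥-elim (ℤ.<-irrefl eq (height-fall a x lt))
... | tri≈ _ eq′ _ = eq′
... | tri> _ _ gt = ⊥-elim (ℤ.<-irrefl (sym eq) (height-climb a x gt))

height-climb⁻ : ∀ a x → height a ℤ.< height (a ++ x) → # 𝟘 x < # 𝟙 x
height-climb⁻ a x lt with ℕ.<-cmp (# 𝟙 x) (# 𝟘 x)
... | tri< lt′ _ _ = ⊥-elim (ℤ.<-asym lt (height-fall a x lt′))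
... | tri≈ _ eq _ = ⊥-elim (ℤ.<-irrefl (sym (height-level a x eq)) lt)
... | tri> _ _ gt = gt

inits-All : ∀ {P : Word → Set} w → (∀ p s → w ≡ p ++ s → P p) → All P (inits w)
inits-All []      f = f [] [] refl ∷ []
inits-All (c ∷ w) f =
  f [] (c ∷ w) refl ∷ All.map⁺ (inits-All w (λ p s eq → f (c ∷ p) s (cong (c ∷_) eq)))

subpath-prefix : ∀ {a} y c → IsSubpath a (𝟙 ∷ y ++ [ c ]) →
                 ∀ p t → y ≡ p ++ t → # 𝟘 p ≤ # 𝟙 p
subpath-prefix {a} y c s p t refl = ℕ.≤-pred (height-climb⁻ a (𝟙 ∷ p)
  (IsSubpath.above s (𝟙 ∷ p) (t ++ [ c ]) (cong (𝟙 ∷_) (++-assoc p t [ c ])) (λ ())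
    (λ eq → case ++-conicalʳ t [ c ] eq of λ ())))

-- After the initial `1` the interior is nonnegative, so a final `1` would leave the subpath
-- strictly above its start.
subpath-Path : ∀ {a x} → IsSubpath a x → ∃[ y ] x ≡ 𝟙 ∷ y ++ [ 𝟘 ] × Path 0 y 0
subpath-Path {a} s with subpath-𝟙 s
... | t , refl with initLast t
...   | [] = case height-level⁻ a [ 𝟙 ] (IsSubpath.returns s) of λ ()
...   | y ∷ʳ′ 𝟙 = ⊥-elim (ℕ.<⇒≢ balance (sym (height-level⁻ a _ (IsSubpath.returns s))))
  where
  balance : # 𝟘 (y ++ [ 𝟙 ]) < suc (# 𝟙 (y ++ [ 𝟙 ]))
  balance rewrite #-++ 𝟘 y [ 𝟙 ] | #-++ 𝟙 y [ 𝟙 ] =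
    s≤s (ℕ.+-mono-≤ (subpath-prefix y 𝟙 s y [] (sym (++-identityʳ y))) z≤n)
...   | y ∷ʳ′ 𝟘 = y , refl , toPath y balance (inits-All y (subpath-prefix y 𝟘 s))
  where
  balance : # 𝟙 y ≡ # 𝟘 y + 0
  balance = begin
    # 𝟙 y              ≡⟨ sym (ℕ.+-identityʳ _) ⟩
    # 𝟙 y + 0          ≡⟨ sym (#-++ 𝟙 y [ 𝟘 ]) ⟩
    # 𝟙 (y ++ [ 𝟘 ])   ≡⟨ ℕ.suc-injective (trans (height-level⁻ a _ (IsSubpath.returns s)) (trans (#-++ 𝟘 y [ 𝟘 ]) (ℕ.+-comm (# 𝟘 y) 1))) ⟩
    # 𝟘 y              ≡⟨ sym (ℕ.+-identityʳ _) ⟩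
    # 𝟘 y + 0          ∎
    where open ≡-Reasoning

Path-≤ : ∀ {w l} → Path 0 w l → # 𝟘 w ≤ # 𝟙 w
Path-≤ {w} {l} P = subst (# 𝟘 w ≤_) (sym (Path-# P)) (ℕ.m≤m+n (# 𝟘 w) l)

-- A proper prefix is `1` followed by a prefix of `y`; that `1` makes the inequality strict.
block-prefix : ∀ {y} → Path 0 y 0 → ∀ p t → 𝟙 ∷ y ++ [ 𝟘 ] ≡ p ++ t → p ≢ [] → t ≢ [] →
               # 𝟘 p < # 𝟙 p
block-prefix Y []      t eq p≢[] t≢[] = ⊥-elim (p≢[] refl)
block-prefix Y (𝟘 ∷ p) t () p≢[] t≢[]
block-prefix {y} Y (𝟙 ∷ p) t eq p≢[] t≢[] with initLast t
... | []       = ⊥-elim (t≢[] refl)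
... | t′ ∷ʳ′ c with refl , refl ← ∷ʳ-injective y (p ++ t′) (trans (∷-injectiveʳ eq) (sym (++-assoc p t′ [ c ])))
  with _ , P , _ ← split p Y = s≤s (Path-≤ P)

block-balance : ∀ {y} → Path 0 y 0 → # 𝟙 (𝟙 ∷ y ++ [ 𝟘 ]) ≡ # 𝟘 (𝟙 ∷ y ++ [ 𝟘 ])
block-balance {y} Y rewrite #-++ 𝟙 y [ 𝟘 ] | #-++ 𝟘 y [ 𝟘 ] | Path-# Y | ℕ.+-identityʳ (# 𝟘 y + 0) | ℕ.+-identityʳ (# 𝟘 y)
  = ℕ.+-comm 1 (# 𝟘 y)

Path-subpath : ∀ a {y} → Path 0 y 0 → IsSubpath a (𝟙 ∷ y ++ [ 𝟘 ])
Path-subpath a Y = record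
  { nonEmpty = λ ()
  ; returns  = height-level a _ (block-balance Y)
  ; above    = λ p t eq p≢[] t≢[] → height-climb a p (block-prefix Y p t eq p≢[] t≢[])
  }

-- Graph edges and steps translated into each other.

⟶⇒Step : ∀ {n} {u v : Dyck n} → u ⟶ v → Step (word u) (word v)
⟶⇒Step (s , suc i , _ , i≤N , eqv) with y , refl , Y ← subpath-Path (Movable.subpath s)
  -- The zeros that are not crossed go into `c`.
  = step (a ++ 0^ (N ∸ suc i)) i y b
      (trans decomposition (trans (cong (a ++_) split-zeros) (sym (++-assoc a _ _))))
      (trans eqv (sym (reassoc a (cong (0^ (N ∸ suc i) ++_) (sym (reassoc (𝟙 ∷ y) refl))))))
      Y (rising followed)
  where
  open Movable s hiding (x)
  split-zeros : 0^ N ++ (𝟙 ∷ y ++ [ 𝟘 ]) ++ b ≡ 0^ (N ∸ suc i) ++ 0^ (suc i) ++ 𝟙 ∷ y ++ 𝟘 ∷ b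
  split-zeros = begin
    0^ N ++ (𝟙 ∷ y ++ [ 𝟘 ]) ++ b                     ≡⟨ cong (0^ N ++_) (reassoc (𝟙 ∷ y) refl) ⟩
    0^ N ++ 𝟙 ∷ y ++ 𝟘 ∷ b                            ≡⟨ cong (λ t → 0^ t ++ 𝟙 ∷ y ++ 𝟘 ∷ b) (sym (ℕ.m∸n+n≡m i≤N)) ⟩
    0^ (N ∸ suc i + suc i) ++ 𝟙 ∷ y ++ 𝟘 ∷ b            ≡⟨ 0^-+ (N ∸ suc i) (suc i) ⟩
    0^ (N ∸ suc i) ++ 0^ (suc i) ++ 𝟙 ∷ y ++ 𝟘 ∷ b      ∎
    where open ≡-Reasoning
  rising : ∀ {b} → b ≡ [] ⊎ ∃[ b′ ] b ≡ 𝟙 ∷ b′ → Rising b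
  rising (inj₁ refl)       = empty
  rising (inj₂ (b′ , refl)) = rise b′

stripZeros-maximal : ∀ p → ¬ (∃[ a ] proj₁ (stripZeros p) ≡ a ∷ʳ 𝟘)
stripZeros-maximal p (a , eq) with stripZeros-last p
... | inj₁ eq′       = case ++-conicalʳ a [ 𝟘 ] (trans (sym eq) eq′) of λ ()
... | inj₂ (r , eq′) = case ∷ʳ-injectiveʳ a r (trans (sym eq) eq′) of λ ()

Step⇒⟶ : ∀ {n} {u v : Dyck n} → Step (word u) (word v) → u ⟶ v
-- The zeros ending `c` complete the crossed ones to the maximal run.
Step⇒⟶ (step c i y b equ eqv Y B) with stripZeros c | stripZeros-++ c | stripZeros-maximal c
... | a , m | refl | maximal
  = record
    { a = a ; x = 𝟙 ∷ y ++ [ 𝟘 ] ; b = b ; N = m + suc i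
    ; decomposition = trans equ (reassoc a (trans (sym (0^-+ m (suc i)))
        (cong (0^ (m + suc i) ++_) (sym (reassoc (𝟙 ∷ y) refl)))))
    ; subpath   = Path-subpath (a ++ 0^ (m + suc i)) Y
    ; preceded  = ℕ.≤-trans (s≤s z≤n) (ℕ.m≤n+m (suc i) m)
    ; followed  = followed B
    ; maximal   = maximal
    }
  , suc i , s≤s z≤n , ℕ.m≤n+m (suc i) m
  , trans eqv (reassoc a (cong₂ (λ k w → 0^ k ++ w) (sym (ℕ.m+n∸n≡m m (suc i))) (sym (reassoc (𝟙 ∷ y) refl))))
  where
  followed : ∀ {b} → Rising b → b ≡ [] ⊎ ∃[ b′ ] b ≡ 𝟙 ∷ b′
  followed empty    = inj₁ refl
  followed (rise b) = inj₂ (b , refl)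

Step-#𝟙 : ∀ {w w′} → Step w w′ → # 𝟙 w ≡ # 𝟙 w′
Step-#𝟙 (step c i y b refl refl Y B)
  rewrite #-++ 𝟙 c (0^ (suc i) ++ 𝟙 ∷ y ++ 𝟘 ∷ b) | #-++ 𝟙 c (𝟙 ∷ y ++ 0^ (suc (suc i)) ++ b)
        | #𝟙-0^ i (𝟙 ∷ y ++ 𝟘 ∷ b) | #-++ 𝟙 y (𝟘 ∷ b) | #-++ 𝟙 y (0^ (suc (suc i)) ++ b) | #𝟙-0^ i b
  = refl

Path⇒Dyck : ∀ {n w} → Path 0 w 0 → # 𝟙 w ≡ n → ∃[ u ] word {n} u ≡ w
Path⇒Dyck {w = w} P #w = record
  { word   = w
  ; ones   = #w
  ; zeros  = trans (sym (trans (Path-# P) (ℕ.+-identityʳ _))) #w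
  ; prefix = Path-prefix P
  } , refl

-- `Factor-unstep` yields bare words; undoing the move makes the source a Dyck path of the same
-- size.
Step-source : ∀ {n w} (u′ : Dyck n) → Step w (word u′) → ∃[ u ] word {n} u ≡ w
Step-source u′ s@(step c i y b refl eq Y B) =
  Path⇒Dyck (slideʳ c i Y (subst (λ w → Path 0 w 0) eq (Dyck⇒Path u′))) (trans (Step-#𝟙 s) (ones u′))

-- The order on products of Dyck paths.

module _ {m n} .{{_ : NonZero m}} .{{_ : NonZero n}} where

  ♯-Factor : (u : Dyck m) (v : Dyck n) → Factor (word u) (word v) (word (u ♯ v))
  ♯-Factor u v =
    let equ , U = bar-Path (nonEmpty u) (Dyck⇒Path u)
        eqv , V = bar-Path (nonEmpty v) (Dyck⇒Path v)
    in subst₂ (λ u′ v′ → Factor u′ v′ (word (u ♯ v))) (sym equ) (sym eqv) (∗-Factor _ _ U V)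

  ♯-injective : ∀ (u u′ : Dyck m) (v v′ : Dyck n) → u ♯ v ≡ u′ ♯ v′ → u ≡ u′ × v ≡ v′
  ♯-injective u u′ v v′ eq =
    let equ , eqv = Factor-injective (♯-Factor u v)
                      (subst (Factor _ _) (sym (cong word eq)) (♯-Factor u′ v′))
                      (trans (ones u) (sym (ones u′)))
    in Dyck-≡ equ , Dyck-≡ eqv

  ♯-monoˡ : ∀ {u u′ : Dyck m} (v : Dyck n) → u ⊑ u′ → u ♯ v ⊑ u′ ♯ v
  ♯-monoˡ v ε = ε
  ♯-monoˡ {u} v (_◅_ {j = u₁} e p) with w , F , s ← Factor-stepˡ (♯-Factor u v) (⟶⇒Step {u = u} {u₁} e)
    = Step⇒⟶ {u = u ♯ v} {u₁ ♯ v} (subst (Step _) (Factor-functional F (♯-Factor u₁ v)) s) ◅ ♯-monoˡ v p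

  ♯-monoʳ : ∀ (u : Dyck m) {v v′ : Dyck n} → v ⊑ v′ → u ♯ v ⊑ u ♯ v′
  ♯-monoʳ u ε = ε
  ♯-monoʳ u {v} (_◅_ {j = v₁} e p) with w , F , s ← Factor-stepʳ (♯-Factor u v) (⟶⇒Step {u = v} {v₁} e)
    = Step⇒⟶ {u = u ♯ v} {u ♯ v₁} (subst (Step _) (Factor-functional F (♯-Factor u v₁)) s) ◅ ♯-monoʳ u p

  ♯-mono : ∀ {u u′ : Dyck m} {v v′ : Dyck n} → u ⊑ u′ → v ⊑ v′ → u ♯ v ⊑ u′ ♯ v′
  ♯-mono {u′ = u′} {v} p q = ♯-monoˡ v p ◅◅ ♯-monoʳ u′ q

  ♯-unstep : ∀ {w : Dyck (m + n ∸ 1)} (u′ : Dyck m) (v′ : Dyck n) → w ⟶ u′ ♯ v′ →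
             ∃[ u ] ∃[ v ] w ≡ u ♯ v × u ⊑ u′ × v ⊑ v′
  ♯-unstep {w} u′ v′ e with Factor-unstep (♯-Factor u′ v′) (⟶⇒Step {u = w} {u′ ♯ v′} e)
  ... | _ , _ , F , inj₁ (s , refl) with u , refl ← Step-source u′ s
    = u , v′ , Dyck-≡ (Factor-functional F (♯-Factor u v′)) , Step⇒⟶ {u = u} {u′} s ◅ ε , ε
  ... | _ , _ , F , inj₂ (refl , s) with v , refl ← Step-source v′ s
    = u′ , v , Dyck-≡ (Factor-functional F (♯-Factor u′ v)) , ε , Step⇒⟶ {u = v} {v′} s ◅ ε

  -- The chain is factored from its top downwards, one edge at a time.
  ♯-downward : ∀ {w w′ : Dyck (m + n ∸ 1)} → w ⊑ w′ → (u′ : Dyck m) (v′ : Dyck n) → w′ ≡ u′ ♯ v′ →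
               ∃[ u ] ∃[ v ] w ≡ u ♯ v × u ⊑ u′ × v ⊑ v′
  ♯-downward ε       u′ v′ eq = u′ , v′ , eq , ε , ε
  ♯-downward {w} (e ◅ p) u′ v′ eq
    with u₁ , v₁ , refl , p₁ , q₁ ← ♯-downward p u′ v′ eq
    with u , v , eq′ , p₂ , q₂ ← ♯-unstep {w} u₁ v₁ e
    = u , v , eq′ , p₂ ◅◅ p₁ , q₂ ◅◅ q₁

  -- `♯-downward` finds factors of `u ♯ v` below `u′` and `v′`; by injectivity they are `u` and `v`.
  ♯-cancel : ∀ (u u′ : Dyck m) (v v′ : Dyck n) → u ♯ v ⊑ u′ ♯ v′ → u ⊑ u′ × v ⊑ v′
  ♯-cancel u u′ v v′ p
    with u₀ , v₀ , eq , p₁ , q₁ ← ♯-downward p u′ v′ refl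
    with refl , refl ← ♯-injective u u₀ v v₀ eq = p₁ , q₁

theorem4p3 : ∀ (m n : ℕ) .{{_ : NonZero m}} .{{_ : NonZero n}}
    (w₁ w₁′ : Dyck m) (w₂ w₂′ : Dyck n) →
    w₁ ⊑ w₁′ → w₂ ⊑ w₂′ →
    Interval (𝒟 (m + n ∸ 1)) (w₁ ♯ w₂) (w₁′ ♯ w₂′)
    ≅ ×-poset (Interval (𝒟 m) w₁ w₁′) (Interval (𝒟 n) w₂ w₂′)
-- The map is the inverse of `♯`: it is monotone because `♯` reflects the order, and reflects the
-- order because `♯` is monotone.
theorem4p3 m n w₁ w₁′ w₂ w₂′ _ _ = factors , record
  { isOrderMonomorphism = record
    { isOrderHomomorphism = record
      { cong = λ {i} {j} eq → ♯-injective (left i) (left j) (right i) (right j)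
                                (trans (sym (factors-♯ i)) (trans eq (factors-♯ j)))
      ; mono = λ {i} {j} p → ♯-cancel (left i) (left j) (right i) (right j)
                               (subst₂ _⊑_ (factors-♯ i) (factors-♯ j) p)
      }
    ; injective = λ {i} {j} (equ , eqv) →
        trans (factors-♯ i) (trans (cong₂ (λ u v → u ♯ v) equ eqv) (sym (factors-♯ j)))
    ; cancel = λ {i} {j} (p , q) →
        subst₂ _⊑_ (sym (factors-♯ i)) (sym (factors-♯ j)) (♯-mono p q)
    }
  ; surjective = λ { ((u , p , p′) , (v , q , q′)) →
      (u ♯ v , ♯-mono p q , ♯-mono p′ q′) ,
      λ {i} eq → ♯-injective (left i) u (right i) v (trans (sym (factors-♯ i)) eq) }
  }
  where
  open Poset using (Carrier)
  I = Carrier (Interval (𝒟 (m + n ∸ 1)) (w₁ ♯ w₂) (w₁′ ♯ w₂′))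

  factorise : (i : I) →
    ∃[ u ] ∃[ v ] proj₁ i ≡ u ♯ v × (w₁ ⊑ u × u ⊑ w₁′) × (w₂ ⊑ v × v ⊑ w₂′)
  factorise (w , lower , upper)
    -- The upper bound puts `w` in the image; the lower bound then splits by cancellation.
    with u , v , refl , p , q ← ♯-downward upper w₁′ w₂′ refl
    with p₀ , q₀ ← ♯-cancel w₁ u w₂ v lower
    = u , v , refl , (p₀ , p) , (q₀ , q)

  left : I → Dyck m
  left i = proj₁ (factorise i)

  right : I → Dyck n
  right i = proj₁ (proj₂ (factorise i))

  factors-♯ : (i : I) → proj₁ i ≡ left i ♯ right i
  factors-♯ i = proj₁ (proj₂ (proj₂ (factorise i)))

  factors : I → Carrier (×-poset (Interval (𝒟 m) w₁ w₁′) (Interval (𝒟 n) w₂ w₂′))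
  factors i =
    let u , v , _ , p , q = factorise i
    in (u , p) , (v , q)
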